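{- Let $N\ge1$ be an integer and $x=[0;d_1,d_2,\ldots]_N\in[0,1]\setminus\mathbb{Q}$. The directive sequence $\boldsymbol{\sigma}_x=(\sigma_n)_{n\ge1}$ of NCF substitutions has a generalized right eigenvector given by the letter frequency vector $(f_0,f_1)=\left(\frac{1}{x+1},\frac{x}{x+1}\right)$ of $\omega(x,N)$.
   Context: Let $N\ge 1$ be an integer and define $T_N:[0,1]\to[0,1]$ by $T_N(x)=\frac{N}{x}-\lfloor\frac{N}{x}\rfloor$ for $x\ne0$ and $T_N(0)=0$. For $x\in[0,1]\setminus\mathbb{Q}$ the (greedy) NCF digits of $x$ are $d_n=\lfloor N/T_N^{n-1}(x)\rfloor\ge N$, $n\ge1$; one writes $x=[0;d_1,d_2,\ldots]_N$. The NCF substitutions of $x$ are $\sigma_n(0)=0^{d_n}1^N$, $\sigma_n(1)=0$, $n\ge1$, extended to finite and infinite words over $\{0,1\}$ by concatenation. Their incidence matrices $M_\sigma=(|\sigma(j)|_i)_{i,j\in\{0,1\}}$ (where $|u|_i$ is the number of occurrences of letter $i$ in $u$) are $M_{\sigma_n}=\begin{pmatrix}d_n&1\\N&0\end{pmatrix}$. The NCF sequence $\omega(x,N)$ is the unique $\omega\in\{0,1\}^{\mathbb{N}}$ for which there exist $\omega^{(1)},\omega^{(2)},\ldots\in\{0,1\}^{\mathbb{N}}$ with $\omega^{(1)}=\omega$ and $\omega^{(n)}=\sigma_n(\omega^{(n+1)})$ for all $n\ge1$. The frequency of a letter $a$ in a sequence is $f_a=\lim_{|p|\to\infty}\frac{|p|_a}{|p|}$,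 the limit being over prefixes $p$ of the sequence. Let $\mathbb{R}^2_+$ be the set of vectors in $\mathbb{R}^2$ with positive entries and $\mathbb{R}_+$ the positive reals. A vector $\mathbf{u}\in\mathbb{R}^2_+$ with $\|\mathbf{u}\|_1=1$ is a generalized right eigenvector of $(\sigma_n)_{n\ge1}$ if $\bigcap_{n\ge1}M_{\sigma_1}\cdots M_{\sigma_n}\mathbb{R}^2_+=\mathbb{R}_+\mathbf{u}$. -}

module Defs where

open import Level using (_⊔_) renaming (suc to lsuc)
open import Algebra.Bundles using (CommutativeRing)
open import Algebra.Apartness.Bundles using (HeytingField; HeytingCommutativeRing)
import Algebra.Definitions.RawMonoid as RawMonoidDefinitions
import Algebra.Properties.Ring as RingProperties
open import Data.Fin.Base using (Fin; zero; suc)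
open import Data.Fin.Properties using (_≟_)
open import Data.Integer.Base as ℤ using (ℤ; +_; -[1+_])
open import Data.List.Base
  using (List; [_]; _++_; length; replicate; filter; concatMap; applyUpTo)
open import Data.Nat.Base as ℕ using (ℕ; zero; suc)
open import Data.Product.Base using (Σ; ∃; _×_; _,_; proj₁; proj₂)
open import Data.Rational.Base as ℚ using (ℚ; ↥_; ↧ₙ_)
open import Data.Sum.Base using (_⊎_; inj₁; inj₂)
open import Data.Vec.Functional using (Vector)
open import Function.Bundles using (_⇔_)
open import Relation.Binary.Core using (Rel)
open import Relation.Binary.PropositionalEquality.Core using (_≡_)
open import Relation.Binary.Structures using (IsStrictPartialOrder)
open import Relation.Nullary.Negation using (¬_; contradiction)

Letter : Set
Letter = Fin 2

Word : Set
Word = List Letter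

InfiniteWord : Set
InfiniteWord = ℕ → Letter

Substitution : Set
Substitution = Letter → Word

∣_∣⟨_⟩ : Word → Letter → ℕ
∣ u ∣⟨ a ⟩ = length (filter (a ≟_) u)

-- ω = σ(ω′) for infinite words: every σ(p), with p a prefix of ω′, is a
-- prefix of ω.  For non-erasing σ (as below) this determines ω.
_IsImageUnder_Of_ : InfiniteWord → Substitution → InfiniteWord → Set
ω IsImageUnder σ Of ω′ =
  ∀ m → let w = concatMap σ (applyUpTo ω′ m) in applyUpTo ω (length w) ≡ w

-- Sequences are indexed from 0: d n stands for d_{n+1}, and similarly for
-- substitutions, matrices and desubstituted words.
ncfSubstitution : (N d : ℕ) → Substitution
ncfSubstitution N d zero       = replicate d zero ++ replicate N (suc zero)
ncfSubstitution N d (suc zero) = [ zero ]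

directiveSequence : (N : ℕ) (d : ℕ → ℕ) → ℕ → Substitution
directiveSequence N d n = ncfSubstitution N (d n)

IsLimitWord : (ℕ → Substitution) → InfiniteWord → Set
IsLimitWord σ ω = Σ (ℕ → InfiniteWord) λ ω⁽_⁾ →
  (∀ k → ω⁽ 0 ⁾ k ≡ ω k) ×
  (∀ n → ω⁽ n ⁾ IsImageUnder σ n Of ω⁽ suc n ⁾)

IsNCFSequence : (N : ℕ) (d : ℕ → ℕ) → InfiniteWord → Set
IsNCFSequence N d = IsLimitWord (directiveSequence N d)

Matrix₂ : Set
Matrix₂ = Letter → Letter → ℕ

incidenceMatrix : Substitution → Matrix₂
incidenceMatrix σ i j = ∣ σ j ∣⟨ i ⟩

infixl 7 _⊗_
_⊗_ : Matrix₂ → Matrix₂ → Matrix₂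
(A ⊗ B) i j = A i zero ℕ.* B zero j ℕ.+ A i (suc zero) ℕ.* B (suc zero) j

-- leadingProduct M n = M 0 ⊗ M 1 ⊗ … ⊗ M n, a product of n + 1 matrices.
leadingProduct : (ℕ → Matrix₂) → ℕ → Matrix₂
leadingProduct M zero    = M zero
leadingProduct M (suc n) = leadingProduct M n ⊗ M (suc n)

-- A constructive ordered field: < need not be decidable, and the apartness
-- x # y means x < y or y < x.
record OrderedField c ℓ₁ ℓ₂ : Set (lsuc (c ⊔ ℓ₁ ⊔ ℓ₂)) where
  field
    heytingField : HeytingField c ℓ₁ ℓ₂

  open HeytingField heytingField public hiding (zero)

  infix 4 _<_
  field
    _<_                  : Rel Carrier ℓ₂
    isStrictPartialOrder : IsStrictPartialOrder _≈_ _<_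
    #⇒<⊎>                : ∀ {x y} → x # y → x < y ⊎ y < x
    <⇒#                  : ∀ {x y} → x < y → x # y
    +-monoˡ-<            : ∀ z {x y} → x < y → x + z < y + z
    *-pos                : ∀ {x y} → 0# < x → 0# < y → 0# < x * y

  open IsStrictPartialOrder isStrictPartialOrder public
    using (<-resp-≈; <-respʳ-≈; <-respˡ-≈)
    renaming (trans to <-trans; irrefl to <-irrefl; asym to <-asym)

  commutativeRing : CommutativeRing c ℓ₁
  commutativeRing = HeytingCommutativeRing.commutativeRing heytingCommutativeRing

  infix 4 _≤_
  _≤_ : Rel Carrier ℓ₂
  x ≤ y = ¬ (y < x)

  private
    module CR = CommutativeRing commutativeRing
    module RP = RingProperties CR.ring
    open RawMonoidDefinitions CR.+-rawMonoid using () renaming (_×_ to _times_)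

  fromℕ : ℕ → Carrier
  fromℕ n = n times 1#

  fromℤ : ℤ → Carrier
  fromℤ (+ n)      = fromℕ n
  fromℤ (-[1+ n ]) = - fromℕ (suc n)

  -- The library's inverse is that of y - 0#, which is equal to y.
  infix 8 _⁻¹[_]
  _⁻¹[_] : ∀ y → y # 0# → Carrier
  y ⁻¹[ y#0 ] = proj₁ (#⇒invertible y#0)

  infixl 7 _/_[_]
  _/_[_] : Carrier → ∀ y → y # 0# → Carrier
  x / y [ y#0 ] = x * y ⁻¹[ y#0 ]

  1#0 : 1# # 0#
  1#0 = invertible⇒# (1# , CR.trans (CR.*-identityˡ _) 1-0≈1 , CR.trans (CR.*-identityʳ _) 1-0≈1)
    where
    1-0≈1 : 1# - 0# ≈ 1#
    1-0≈1 = CR.trans (CR.+-congˡ RP.-0#≈0#) (CR.+-identityʳ 1#)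

  0<1 : 0# < 1#
  0<1 with #⇒<⊎> 1#0
  ... | inj₂ 0<1 = 0<1
  ... | inj₁ 1<0 = <-respʳ-≈ [-1]²≈1 (*-pos 0<-1 0<-1)
    where
    0<-1 : 0# < - 1#
    0<-1 = <-respʳ-≈ (CR.+-identityˡ _) (<-respˡ-≈ (CR.-‿inverseʳ 1#) (+-monoˡ-< (- 1#) 1<0))
    [-1]²≈1 : - 1# * - 1# ≈ 1#
    [-1]²≈1 = CR.trans (RP.-1*x≈-x (- 1#)) (RP.-‿involutive 1#)

  0<x⇒0<x+1 : ∀ {x} → 0# < x → 0# < x + 1#
  0<x⇒0<x+1 0<x = <-trans 0<1 (<-respˡ-≈ (CR.+-identityˡ 1#) (+-monoˡ-< 1# 0<x))

  0≤x⇒0<x+1 : ∀ {x} → 0# ≤ x → 0# < x + 1#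
  0≤x⇒0<x+1 {x} 0≤x with #-cotrans (<⇒# 0<1) (x + 1#)
  ... | inj₁ 0#x+1 with #⇒<⊎> 0#x+1
  ...   | inj₁ 0<x+1 = 0<x+1
  ...   | inj₂ x+1<0 = contradiction (<-trans x<-1 -1<0) 0≤x
    where
    x<-1 : x < - 1#
    x<-1 = <-respʳ-≈ (CR.+-identityˡ _)
             (<-respˡ-≈ (CR.trans (CR.+-assoc _ _ _)
                          (CR.trans (CR.+-congˡ (CR.-‿inverseʳ 1#)) (CR.+-identityʳ x)))
               (+-monoˡ-< (- 1#) x+1<0))
    -1<0 : - 1# < 0#
    -1<0 = <-respʳ-≈ (CR.-‿inverseʳ 1#)
             (<-respˡ-≈ (CR.+-identityˡ _) (+-monoˡ-< (- 1#) 0<1))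
  0≤x⇒0<x+1 {x} 0≤x | inj₂ x+1#1 with #⇒<⊎> x+1#1
  ...   | inj₂ 1<x+1 = <-trans 0<1 1<x+1
  ...   | inj₁ x+1<1 = contradiction x<0 0≤x
    where
    x<0 : x < 0#
    x<0 = <-respʳ-≈ (CR.-‿inverseʳ 1#)
            (<-respˡ-≈ (CR.trans (CR.+-assoc _ _ _)
                         (CR.trans (CR.+-congˡ (CR.-‿inverseʳ 1#)) (CR.+-identityʳ x)))
              (+-monoˡ-< (- 1#) x+1<1))

  0≤x⇒x+1#0 : ∀ {x} → 0# ≤ x → x + 1# # 0#
  0≤x⇒x+1#0 0≤x = #-sym (<⇒# (0≤x⇒0<x+1 0≤x))

  0<fromℕ[1+n] : ∀ n → 0# < fromℕ (suc n)
  0<fromℕ[1+n] zero    = <-respʳ-≈ (CR.sym (CR.+-identityʳ 1#)) 0<1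
  0<fromℕ[1+n] (suc n) = <-respʳ-≈ (CR.+-comm _ 1#) (0<x⇒0<x+1 (0<fromℕ[1+n] n))

  fromℕ[1+n]#0 : ∀ n → fromℕ (suc n) # 0#
  fromℕ[1+n]#0 n = #-sym (<⇒# (0<fromℕ[1+n] n))

  fromℚ : ℚ → Carrier
  fromℚ q = fromℤ (↥ q) / fromℕ (↧ₙ q) [ fromℕ[1+n]#0 (ℚ.denominator-1 q) ]

  ∣_-_∣<_ : Carrier → Carrier → Carrier → Set ℓ₂
  ∣ x - y ∣< ε = x < y + ε × y < x + ε

  _ConvergesTo_ : (ℕ → Carrier) → Carrier → Set (c ⊔ ℓ₂)
  s ConvergesTo L = ∀ ε → 0# < ε → ∃ λ K → ∀ n → K ℕ.≤ n → ∣ s n - L ∣< ε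

  IsCauchy : (ℕ → Carrier) → Set (c ⊔ ℓ₂)
  IsCauchy s =
    ∀ ε → 0# < ε → ∃ λ K → ∀ m n → K ℕ.≤ m → K ℕ.≤ n → ∣ s m - s n ∣< ε

-- ℝ is characterised, up to isomorphism, as the complete Archimedean ordered
-- field.
record RealNumbers c ℓ₁ ℓ₂ : Set (lsuc (c ⊔ ℓ₁ ⊔ ℓ₂)) where
  field
    orderedField : OrderedField c ℓ₁ ℓ₂

  open OrderedField orderedField public

  field
    archimedean : ∀ x → ∃ λ n → x < fromℕ n
    complete    : ∀ s → IsCauchy s → ∃ λ L → s ConvergesTo L

module NCF {c ℓ₁ ℓ₂} (ℝ : RealNumbers c ℓ₁ ℓ₂) where

  open RealNumbers ℝ

  Irrational : Carrier → Set ℓ₁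
  Irrational x = ¬ (∃ λ (q : ℚ) → x ≈ fromℚ q)

  -- k = ⌊ y ⌋, for y ≥ 0
  IsFloor : Carrier → ℕ → Set ℓ₂
  IsFloor y k = fromℕ k ≤ y × y < fromℕ (suc k)

  -- The graph y = T_N(x).  T_N is discontinuous, so it is not given as a
  -- function Carrier → Carrier.
  data IsGaussImage (N : ℕ) (x y : Carrier) : Set (c ⊔ ℓ₁ ⊔ ℓ₂) where
    at-zero  : x ≈ 0# → y ≈ 0# → IsGaussImage N x y
    non-zero : (x#0 : x # 0#) (k : ℕ) → IsFloor (fromℕ N / x [ x#0 ]) k →
               y ≈ fromℕ N / x [ x#0 ] - fromℕ k → IsGaussImage N x y

  -- x = [0; d 0, d 1, …]_N:  t n is the iterate T_N^n(x), and
  -- d n = ⌊ N / T_N^n(x) ⌋.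
  IsNCFExpansion : (N : ℕ) → Carrier → (ℕ → ℕ) → Set (c ⊔ ℓ₁ ⊔ ℓ₂)
  IsNCFExpansion N x d = Σ (ℕ → Carrier) λ t →
    t 0 ≈ x ×
    (∀ n → IsGaussImage N (t n) (t (suc n))) ×
    (∀ n → Σ (t n # 0#) λ tn#0 → IsFloor (fromℕ N / t n [ tn#0 ]) (d n))

  -- |p|_a / |p| for the prefix p of length n + 1.
  prefixFrequency : Letter → InfiniteWord → ℕ → Carrier
  prefixFrequency a ω n =
    fromℕ ∣ applyUpTo ω (suc n) ∣⟨ a ⟩ / fromℕ (suc n) [ fromℕ[1+n]#0 n ]

  HasFrequency : InfiniteWord → Letter → Carrier → Set (c ⊔ ℓ₂)
  HasFrequency ω a f = prefixFrequency a ω ConvergesTo f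

  ℝ² : Set c
  ℝ² = Vector Carrier 2

  infix 4 _≈²_
  _≈²_ : Rel ℝ² ℓ₁
  v ≈² w = ∀ i → v i ≈ w i

  Positive : ℝ² → Set ℓ₂
  Positive v = ∀ i → 0# < v i

  infixr 7 _·_ _∙_
  _·_ : Matrix₂ → ℝ² → ℝ²
  (M · v) i = fromℕ (M i zero) * v zero + fromℕ (M i (suc zero)) * v (suc zero)

  _∙_ : Carrier → ℝ² → ℝ²
  (r ∙ v) i = r * v i

  -- v ∈ M ℝ²₊
  _∈Cone_ : ℝ² → Matrix₂ → Set (c ⊔ ℓ₁ ⊔ ℓ₂)
  v ∈Cone M = ∃ λ w → Positive w × v ≈² M · w

  -- v ∈ ℝ₊ u
  _∈Ray_ : ℝ² → ℝ² → Set (c ⊔ ℓ₁ ⊔ ℓ₂)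
  v ∈Ray u = ∃ λ r → 0# < r × v ≈² r ∙ u

  record IsGeneralizedRightEigenvector
    (σ : ℕ → Substitution) (u : ℝ²) : Set (c ⊔ ℓ₁ ⊔ ℓ₂) where
    field
      positive     : Positive u
      -- ‖u‖₁ = 1; the absolute values are redundant for positive u
      normalised   : u zero + u (suc zero) ≈ 1#
      intersection : ∀ v →
        (∀ n → v ∈Cone leadingProduct (λ k → incidenceMatrix (σ k)) n) ⇔ v ∈Ray u

{-# OPTIONS --safe #-}

-- Put δₙ(v) = v₁ - tₙ v₀ with tₙ = T_N^n(x).  Since N = tₙ (dₙ + tₙ₊₁), the n-th
-- incidence matrix M satisfies δₙ(M w) = - tₙ δₙ₊₁(w), so applying the first n
-- matrices scales δ by t₀ ⋯ tₙ₋₁, and this tends to 0 because tₙ tₙ₊₁ ≤ N/(N+1).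
-- As ∣δ(w)∣ ≤ ‖w‖₁, a vector v in all the cones has v₁ = x v₀; conversely M maps
-- the ray of (1, tₙ₊₁) onto that of (1, tₙ).  For frequencies, δ is applied to the
-- letter counts of a prefix p of ω: desubstituting p n times costs at most N per
-- level (the incomplete block), hence ∣δ₀(p)∣ ≤ t₀ ⋯ tₙ₋₁ ∣p∣ + N n for every n.
-- Inequalities are kept free of subtraction so that they are semiring inequalities.
module Submission where

open import Defs
open import Algebra.Bundles using (CommutativeRing)
import Algebra.Apartness.Properties.HeytingCommutativeRing as HeytingCommutativeRingProperties
import Algebra.Properties.Semiring.Mult as SemiringMult
import Algebra.Solver.Ring.NaturalCoefficients.Default as SemiringSolver
open import Data.Fin.Base using (zero; suc)
open import Data.Fin.Properties using (_≟_)
open import Data.List.Base using (_++_; length; replicate; filter; concatMap; applyUpTo)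
open import Data.List.Properties using
  (filter-++; filter-all; filter-none; length-++; length-++-≤ˡ; length-replicate;
   length-applyUpTo; ++-assoc; ∷-injective)
open import Data.List.Relation.Unary.All.Properties using (replicate⁺)
open import Data.Nat.Base as ℕ using (ℕ; zero; suc; _≥_; z≤n; s≤s)
import Data.Nat.Properties as ℕₚ
open import Data.Nat.Solver using (module +-*-Solver)
open import Data.Product.Base using (Σ; ∃; _×_; _,_; proj₁; proj₂)
open import Data.Sum.Base using (_⊎_; inj₁; inj₂; [_,_]′)
open import Function.Base using (_∘_)
open import Function.Bundles using (mk⇔)
open import Relation.Binary.PropositionalEquality.Core as ≡ using (_≡_; _≢_)
import Relation.Binary.Reasoning.Base.Triple as TripleReasoning
open import Relation.Binary.Structures using (IsPreorder)
open import Relation.Nullary.Negation using (contradiction)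

-- Order arithmetic in a constructive ordered field.

module OrderedFieldProperties {c ℓ₁ ℓ₂} (F : OrderedField c ℓ₁ ℓ₂) where

  open OrderedField F
  open CommutativeRing commutativeRing public
    using (semiring; commutativeSemiring)
  open HeytingCommutativeRingProperties heytingCommutativeRing public
    using (x-0≈x; invertibleˡ⇒#)
  open SemiringMult semiring public using (×-homo-+; ×1-homo-*)
  open SemiringSolver commutativeSemiring public using (solve; _:=_; _:+_; _:*_)

  cancel-+-neg : ∀ x z → z + x + - z ≈ x
  cancel-+-neg x z = trans (+-congʳ (+-comm z x)) (trans (+-assoc x z _)
    (trans (+-congˡ (-‿inverseʳ z)) (+-identityʳ x)))

  +-diff : ∀ x y → x + (y - x) ≈ y
  +-diff x y = trans (sym (+-assoc x y _)) (cancel-+-neg y x)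

  -- Takes the place of trichotomy. Cotransitivity of the apartness separates `y` from one of the
  -- endpoints; if the sign comes out the wrong way, chaining with `x < z` settles the other
  -- comparison. Since `≤` is a negation, the transitivity laws involving it all come from this case
  -- split.
  <-cotrans : ∀ {x z} → x < z → ∀ y → x < y ⊎ y < z
  <-cotrans x<z y with #-cotrans (<⇒# x<z) y
  ... | inj₁ x#y = [ inj₁ , (λ y<x → inj₂ (<-trans y<x x<z)) ]′ (#⇒<⊎> x#y)
  ... | inj₂ y#z = [ inj₂ , (λ z<y → inj₁ (<-trans x<z z<y)) ]′ (#⇒<⊎> y#z)

  ≤-reflexive : ∀ {x y} → x ≈ y → x ≤ y
  ≤-reflexive x≈y = <-irrefl (sym x≈y)

  ≤-refl : ∀ {x} → x ≤ x
  ≤-refl = ≤-reflexive refl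

  <⇒≤ : ∀ {x y} → x < y → x ≤ y
  <⇒≤ = <-asym

  ≤-trans : ∀ {x y z} → x ≤ y → y ≤ z → x ≤ z
  ≤-trans {y = y} x≤y y≤z z<x = [ y≤z , x≤y ]′ (<-cotrans z<x y)

  <-≤-trans : ∀ {x y z} → x < y → y ≤ z → x < z
  <-≤-trans {z = z} x<y y≤z = [ (λ x<z → x<z) , (λ z<y → contradiction z<y y≤z) ]′ (<-cotrans x<y z)

  ≤-<-trans : ∀ {x y z} → x ≤ y → y < z → x < z
  ≤-<-trans {x} x≤y y<z = [ (λ y<x → contradiction y<x x≤y) , (λ x<z → x<z) ]′ (<-cotrans y<z x)

  -- Tightness of the apartness: elements that are not apart are equal, and `x # y` would contradict
  -- one of the two bounds.
  ≤-antisym : ∀ {x y} → x ≤ y → y ≤ x → x ≈ y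
  ≤-antisym {x} {y} x≤y y≤x = proj₁ (tight x y) (λ x#y → [ y≤x , x≤y ]′ (#⇒<⊎> x#y))

  ≤-isPreorder : IsPreorder _≈_ _≤_
  ≤-isPreorder = record { isEquivalence = isEquivalence ; reflexive = ≤-reflexive ; trans = ≤-trans }

  module ≤-Reasoning = TripleReasoning ≤-isPreorder
    <-asym <-trans <-resp-≈ <⇒≤ <-≤-trans ≤-<-trans

  +-monoʳ-< : ∀ z {x y} → x < y → z + x < z + y
  +-monoʳ-< z x<y = <-respˡ-≈ (+-comm _ z) (<-respʳ-≈ (+-comm _ z) (+-monoˡ-< z x<y))

  +-monoʳ-≤ : ∀ z {x y} → x ≤ y → z + x ≤ z + y
  +-monoʳ-≤ z {x} {y} x≤y z+y<z+x =
    x≤y (<-respˡ-≈ (cancel-+-neg y z) (<-respʳ-≈ (cancel-+-neg x z) (+-monoˡ-< (- z) z+y<z+x)))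

  +-monoˡ-≤ : ∀ z {x y} → x ≤ y → x + z ≤ y + z
  +-monoˡ-≤ z {x} {y} x≤y = ≤-trans (≤-reflexive (+-comm x z))
    (≤-trans (+-monoʳ-≤ z x≤y) (≤-reflexive (+-comm z y)))

  +-mono-≤ : ∀ {x y u v} → x ≤ y → u ≤ v → x + u ≤ y + v
  +-mono-≤ {y = y} {u} x≤y u≤v = ≤-trans (+-monoˡ-≤ u x≤y) (+-monoʳ-≤ y u≤v)

  x≤x+y : ∀ {x y} → 0# ≤ y → x ≤ x + y
  x≤x+y {x} 0≤y = ≤-trans (≤-reflexive (sym (+-identityʳ x))) (+-monoʳ-≤ x 0≤y)

  x≤y+x : ∀ {x y} → 0# ≤ y → x ≤ y + x
  x≤y+x {x} {y} 0≤y = ≤-trans (x≤x+y 0≤y) (≤-reflexive (+-comm x y))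

  +-nonneg : ∀ {x y} → 0# ≤ x → 0# ≤ y → 0# ≤ x + y
  +-nonneg 0≤x 0≤y = ≤-trans 0≤x (x≤x+y 0≤y)

  +-pos-nonneg : ∀ {x y} → 0# < x → 0# ≤ y → 0# < x + y
  +-pos-nonneg 0<x 0≤y = <-≤-trans 0<x (x≤x+y 0≤y)

  x<y⇒0<y-x : ∀ {x y} → x < y → 0# < y - x
  x<y⇒0<y-x {x} x<y = <-respˡ-≈ (-‿inverseʳ x) (+-monoˡ-< (- x) x<y)

  x≤y⇒0≤y-x : ∀ {x y} → x ≤ y → 0# ≤ y - x
  x≤y⇒0≤y-x {x} x≤y = ≤-trans (≤-reflexive (sym (-‿inverseʳ x))) (+-monoˡ-≤ (- x) x≤y)

  +-cancelˡ-≤ : ∀ z {x y} → z + x ≤ z + y → x ≤ y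
  +-cancelˡ-≤ z z+x≤z+y y<x = z+x≤z+y (+-monoʳ-< z y<x)

  -- If `i` inverts `x * y`, then `i * y` is a left inverse of `x`, and invertibility yields
  -- apartness. The rewrites by `x-0≈x` occur because what is inverted is the difference with `0#`.
  *#0⇒#0 : ∀ {x y} → x * y # 0# → x # 0#
  *#0⇒#0 {x} {y} xy#0 with #⇒invertible xy#0
  ... | i , i*xy≈1 , _ = invertibleˡ⇒# (i * y , trans (*-congˡ (x-0≈x x))
    (trans (solve 3 (λ i x y → (i :* y) :* x := i :* (x :* y)) refl i x y)
    (trans (*-congˡ (sym (x-0≈x (x * y)))) i*xy≈1)))

  nonneg∧#0⇒pos : ∀ {x} → 0# ≤ x → x # 0# → 0# < x
  nonneg∧#0⇒pos 0≤x x#0 = [ (λ x<0 → contradiction x<0 0≤x) , (λ 0<x → 0<x) ]′ (#⇒<⊎> x#0)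

  -- A factor cannot be split into zero or positive, so the negation is used: if `x * y < 0#`, both
  -- factors are apart from 0, hence positive, and so is their product.
  *-nonneg : ∀ {x y} → 0# ≤ x → 0# ≤ y → 0# ≤ x * y
  *-nonneg {x} {y} 0≤x 0≤y xy<0 = <-asym xy<0 (*-pos
    (nonneg∧#0⇒pos 0≤x (*#0⇒#0 (<⇒# xy<0)))
    (nonneg∧#0⇒pos 0≤y (*#0⇒#0 (<⇒# (<-respˡ-≈ (*-comm x y) xy<0)))))

  *-monoˡ-≤ : ∀ {z x y} → 0# ≤ z → x ≤ y → z * x ≤ z * y
  *-monoˡ-≤ {z} {x} {y} 0≤z x≤y = begin
    z * x                   ≤⟨ x≤x+y (*-nonneg 0≤z (x≤y⇒0≤y-x x≤y)) ⟩
    z * x + z * (y - x)     ≈⟨ distribˡ z x _ ⟨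
    z * (x + (y - x))       ≈⟨ *-congˡ (+-diff x y) ⟩
    z * y                   ∎
    where open ≤-Reasoning

  *-monoʳ-≤ : ∀ {z x y} → 0# ≤ z → x ≤ y → x * z ≤ y * z
  *-monoʳ-≤ {z} {x} {y} 0≤z x≤y = ≤-trans (≤-reflexive (*-comm x z))
    (≤-trans (*-monoˡ-≤ 0≤z x≤y) (≤-reflexive (*-comm z y)))

  *-monoˡ-< : ∀ {z x y} → 0# < z → x < y → z * x < z * y
  *-monoˡ-< {z} {x} {y} 0<z x<y = begin-strict
    z * x                   ≈⟨ +-identityʳ _ ⟨
    z * x + 0#              <⟨ +-monoʳ-< _ (*-pos 0<z (x<y⇒0<y-x x<y)) ⟩
    z * x + z * (y - x)     ≈⟨ distribˡ z x _ ⟨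
    z * (x + (y - x))       ≈⟨ *-congˡ (+-diff x y) ⟩
    z * y                   ∎
    where open ≤-Reasoning

  0≤1 : 0# ≤ 1#
  0≤1 = <⇒≤ 0<1

  ⁻¹-inverseʳ : ∀ y (y#0 : y # 0#) → y * y ⁻¹[ y#0 ] ≈ 1#
  ⁻¹-inverseʳ y y#0 = trans (*-congʳ (sym (x-0≈x y))) (proj₂ (proj₂ (#⇒invertible y#0)))

  -- As a factor of 1, `i` is apart from 0; `i < 0#` would give `1# < 0#` after multiplication by
  -- `y`.
  inverse-pos : ∀ {y i} → 0# < y → y * i ≈ 1# → 0# < i
  inverse-pos {y} {i} 0<y yi≈1 with #⇒<⊎> (*#0⇒#0 {i} {y} (#-sym (<⇒# (<-respʳ-≈ (trans (sym yi≈1) (*-comm y i)) 0<1))))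
  ... | inj₂ 0<i = 0<i
  ... | inj₁ i<0 = contradiction (<-respˡ-≈ yi≈1 (<-respʳ-≈ (zeroʳ y) (*-monoˡ-< 0<y i<0))) 0≤1

  -- Multiply the hypothesis by the positive `y′ * z′`. Inverses enter as arbitrary elements with an
  -- equation, so no apartness proof has to be carried along.
  cross-multiply-< : ∀ {a b e y z y′ z′} → 0# < y → 0# < z → y * y′ ≈ 1# → z * z′ ≈ 1# →
                     a * z < b * y + e * (y * z) → a * y′ < b * z′ + e
  cross-multiply-< {a} {b} {e} {y} {z} {y′} {z′} 0<y 0<z yy′≈1 zz′≈1 az<by+eyz = begin-strict
    a * y′                                         ≈⟨ *-identityʳ _ ⟨
    a * y′ * 1#                                    ≈⟨ *-congˡ zz′≈1 ⟨
    a * y′ * (z * z′)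
      ≈⟨ solve 4 (λ a y′ z z′ → a :* y′ :* (z :* z′) := y′ :* z′ :* (a :* z)) refl a y′ z z′ ⟩
    y′ * z′ * (a * z)
      <⟨ *-monoˡ-< (*-pos (inverse-pos 0<y yy′≈1) (inverse-pos 0<z zz′≈1)) az<by+eyz ⟩
    y′ * z′ * (b * y + e * (y * z))
      ≈⟨ solve 6 (λ b e y z y′ z′ → y′ :* z′ :* (b :* y :+ e :* (y :* z)) := b :* z′ :* (y :* y′) :+ e :* (y :* y′) :* (z :* z′)) refl b e y z y′ z′ ⟩
    b * z′ * (y * y′) + e * (y * y′) * (z * z′)    ≈⟨ +-cong (*-congˡ yy′≈1) (*-cong (*-congˡ yy′≈1) zz′≈1) ⟩
    b * z′ * 1# + e * 1# * 1#
      ≈⟨ +-cong (*-identityʳ _) (trans (*-identityʳ _) (*-identityʳ _)) ⟩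
    b * z′ + e                                     ∎
    where open ≤-Reasoning

  *-cancelˡ-< : ∀ {z x y} → 0# < z → z * x < z * y → x < y
  *-cancelˡ-< {z} {x} {y} 0<z zx<zy = begin-strict
    x              ≈⟨ cancel x ⟨
    i * (z * x)    <⟨ *-monoˡ-< (inverse-pos 0<z zi≈1) zx<zy ⟩
    i * (z * y)    ≈⟨ cancel y ⟩
    y              ∎
    where
    open ≤-Reasoning
    z#0 = #-sym (<⇒# 0<z)
    i = z ⁻¹[ z#0 ]
    zi≈1 = ⁻¹-inverseʳ z z#0
    cancel : ∀ w → i * (z * w) ≈ w
    cancel w = trans (sym (*-assoc i z w)) (trans (*-congʳ (trans (*-comm i z) zi≈1)) (*-identityˡ w))

  fromℕ-+ : ∀ m n → fromℕ (m ℕ.+ n) ≈ fromℕ m + fromℕ n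
  fromℕ-+ = ×-homo-+ 1#

  fromℕ-* : ∀ m n → fromℕ (m ℕ.* n) ≈ fromℕ m * fromℕ n
  fromℕ-* = ×1-homo-*

  fromℕ-1 : fromℕ 1 ≈ 1#
  fromℕ-1 = +-identityʳ 1#

  0≤fromℕ : ∀ n → 0# ≤ fromℕ n
  0≤fromℕ zero    = ≤-refl
  0≤fromℕ (suc n) = <⇒≤ (0<fromℕ[1+n] n)

  fromℕ-mono-≤ : ∀ {m n} → m ℕ.≤ n → fromℕ m ≤ fromℕ n
  fromℕ-mono-≤ {m} {n} m≤n = begin
    fromℕ m                      ≤⟨ x≤x+y (0≤fromℕ (n ℕ.∸ m)) ⟩
    fromℕ m + fromℕ (n ℕ.∸ m)    ≈⟨ fromℕ-+ m (n ℕ.∸ m) ⟨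
    fromℕ (m ℕ.+ (n ℕ.∸ m))      ≡⟨ ≡.cong fromℕ (ℕₚ.m+[n∸m]≡n m≤n) ⟩
    fromℕ n                      ∎
    where open ≤-Reasoning

  fromℕ-cancel-< : ∀ {m n} → fromℕ m < fromℕ n → m ℕ.< n
  fromℕ-cancel-< m<n = ℕₚ.≰⇒> (λ n≤m → fromℕ-mono-≤ n≤m m<n)

  -- The non-strict counterpart of `∣_-_∣<_`: a bound on the absolute value of `y - z` that forms
  -- neither absolute value nor difference.
  Within : Carrier → Carrier → Carrier → Set ℓ₂
  Within b y z = y ≤ z + b × z ≤ y + b

  Within-weaken : ∀ {b b′ y z} → b ≤ b′ → Within b y z → Within b′ y z
  Within-weaken b≤b′ (y≤ , z≤) = ≤-trans y≤ (+-monoʳ-≤ _ b≤b′) , ≤-trans z≤ (+-monoʳ-≤ _ b≤b′)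

  Within-cong : ∀ {b b′ y y′ z z′} → b ≈ b′ → y ≈ y′ → z ≈ z′ → Within b y z → Within b′ y′ z′
  Within-cong {b} {b′} {y} {y′} {z} {z′} b≈ y≈ z≈ (y≤ , z≤) =
    (begin y′ ≈⟨ y≈ ⟨ y ≤⟨ y≤ ⟩ z + b ≈⟨ +-cong z≈ b≈ ⟩ z′ + b′ ∎) ,
    (begin z′ ≈⟨ z≈ ⟨ z ≤⟨ z≤ ⟩ y + b ≈⟨ +-cong y≈ b≈ ⟩ y′ + b′ ∎)
    where open ≤-Reasoning

  Within-+ : ∀ {b b′ y y′ z z′} → Within b y z → Within b′ y′ z′ → Within (b + b′) (y + y′) (z + z′)
  Within-+ (y≤ , z≤) (y′≤ , z′≤) =
    ≤-trans (+-mono-≤ y≤ y′≤) (≤-reflexive (exchange _ _ _ _)) ,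
    ≤-trans (+-mono-≤ z≤ z′≤) (≤-reflexive (exchange _ _ _ _))
    where
    exchange : ∀ x b x′ b′ → (x + b) + (x′ + b′) ≈ (x + x′) + (b + b′)
    exchange = solve 4 (λ x b x′ b′ → (x :+ b) :+ (x′ :+ b′) := (x :+ x′) :+ (b :+ b′)) refl

  Within-sym : ∀ {b y z} → Within b y z → Within b z y
  Within-sym (y≤ , z≤) = z≤ , y≤

  Within-scale : ∀ {w b y z} → 0# ≤ w → Within b y z → Within (w * b) (w * y) (w * z)
  Within-scale 0≤w (y≤ , z≤) =
    ≤-trans (*-monoˡ-≤ 0≤w y≤) (≤-reflexive (distribˡ _ _ _)) ,
    ≤-trans (*-monoˡ-≤ 0≤w z≤) (≤-reflexive (distribˡ _ _ _))

  Within-translate : ∀ {w b y z} → Within b y z → Within b (w + y) (w + z)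
  Within-translate (y≤ , z≤) =
    ≤-trans (+-monoʳ-≤ _ y≤) (≤-reflexive (sym (+-assoc _ _ _))) ,
    ≤-trans (+-monoʳ-≤ _ z≤) (≤-reflexive (sym (+-assoc _ _ _)))

-- Letter counts and desubstitution of prefixes.

module WordProperties where

  open import Data.List.Base using ([]; _∷_)
  open import Data.Nat.Base using (_+_; _≤_)
  open ℕₚ using (≤-trans; +-assoc; +-suc; +-identityʳ; +-mono-≤; *-zeroʳ; m≤m+n; m+[n∸m]≡n)
  open ≡ using (refl; sym; trans; cong; cong₂; subst; subst₂)
  open +-*-Solver using (solve; _:=_; _:+_; _:*_; con)

  ∣++∣ : ∀ u v a → ∣ u ++ v ∣⟨ a ⟩ ≡ ∣ u ∣⟨ a ⟩ + ∣ v ∣⟨ a ⟩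
  ∣++∣ u v a = trans (cong length (filter-++ (a ≟_) u v)) (length-++ (filter (a ≟_) u))

  ∣∣-monoˡ : ∀ u v a → ∣ u ∣⟨ a ⟩ ≤ ∣ u ++ v ∣⟨ a ⟩
  ∣∣-monoˡ u v a = subst (∣ u ∣⟨ a ⟩ ≤_) (sym (∣++∣ u v a)) (m≤m+n _ _)

  ∣replicate∣-same : ∀ n a → ∣ replicate n a ∣⟨ a ⟩ ≡ n
  ∣replicate∣-same n a = trans (cong length (filter-all (a ≟_) (replicate⁺ n refl))) (length-replicate n)

  ∣replicate∣-other : ∀ n {a b} → a ≢ b → ∣ replicate n b ∣⟨ a ⟩ ≡ 0
  ∣replicate∣-other n {a} a≢b = cong length (filter-none (a ≟_) (replicate⁺ n a≢b))

  ∣0∣+∣1∣ : ∀ u → ∣ u ∣⟨ zero ⟩ + ∣ u ∣⟨ suc zero ⟩ ≡ length u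
  ∣0∣+∣1∣ []             = refl
  ∣0∣+∣1∣ (zero ∷ u)     = cong suc (∣0∣+∣1∣ u)
  ∣0∣+∣1∣ (suc zero ∷ u) = trans (+-suc _ _) (cong suc (∣0∣+∣1∣ u))

  -- Abelianisation: each letter of `u` contributes its column of the incidence matrix.
  ∣concatMap∣ : ∀ σ u a → let M = incidenceMatrix σ in
    ∣ concatMap σ u ∣⟨ a ⟩ ≡ M a zero ℕ.* ∣ u ∣⟨ zero ⟩ + M a (suc zero) ℕ.* ∣ u ∣⟨ suc zero ⟩
  ∣concatMap∣ σ [] a = sym (cong₂ _+_ (*-zeroʳ (incidenceMatrix σ a zero)) (*-zeroʳ (incidenceMatrix σ a (suc zero))))
  ∣concatMap∣ σ (zero ∷ u) a = trans (∣++∣ (σ zero) (concatMap σ u) a) (trans (cong (m +_) (∣concatMap∣ σ u a))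
    (solve 3 (λ m x y → m :+ (m :* x :+ y) := m :* (con 1 :+ x) :+ y) refl m ∣ u ∣⟨ zero ⟩ _))
    where m = incidenceMatrix σ a zero
  ∣concatMap∣ σ (suc zero ∷ u) a = trans (∣++∣ (σ (suc zero)) (concatMap σ u) a) (trans (cong (m +_) (∣concatMap∣ σ u a))
    (solve 3 (λ m x y → m :+ (y :+ m :* x) := y :+ m :* (con 1 :+ x)) refl m ∣ u ∣⟨ suc zero ⟩ (incidenceMatrix σ a zero ℕ.* ∣ u ∣⟨ zero ⟩)))
    where m = incidenceMatrix σ a (suc zero)

  module _ (N d : ℕ) where

    private M = incidenceMatrix (ncfSubstitution N d)

    incidence₀₀ : M zero zero ≡ d
    incidence₀₀ = trans (∣++∣ (replicate d zero) _ zero)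
      (trans (cong₂ _+_ (∣replicate∣-same d zero) (∣replicate∣-other N λ ())) (+-identityʳ d))

    incidence₁₀ : M (suc zero) zero ≡ N
    incidence₁₀ = trans (∣++∣ (replicate d zero) _ (suc zero))
      (cong₂ _+_ (∣replicate∣-other d λ ()) (∣replicate∣-same N (suc zero)))

  NonErasing : Substitution → Set
  NonErasing σ = ∀ a → 1 ≤ length (σ a)

  ncfSubstitution-nonErasing : ∀ N {d} → 1 ≤ d → NonErasing (ncfSubstitution N d)
  ncfSubstitution-nonErasing N (s≤s _) zero       = s≤s z≤n
  ncfSubstitution-nonErasing N _       (suc zero) = s≤s z≤n

  length≤length-concatMap : ∀ {σ} → NonErasing σ → ∀ u → length u ≤ length (concatMap σ u)
  length≤length-concatMap σ≢[] []      = z≤n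
  length≤length-concatMap {σ} σ≢[] (a ∷ u) = subst (suc (length u) ≤_) (sym (length-++ (σ a)))
    (+-mono-≤ (σ≢[] a) (length≤length-concatMap σ≢[] u))

  infix 4 _≼_ _≼∞_
  _≼_ : Word → Word → Set
  u ≼ v = ∃ λ w → u ++ w ≡ v

  _≼∞_ : Word → InfiniteWord → Set
  u ≼∞ ω = applyUpTo ω (length u) ≡ u

  ≼-compare : ∀ {p} u {v} → p ≼ u ++ v → p ≼ u ⊎ (∃ λ q → p ≡ u ++ q × q ≼ v)
  ≼-compare {p}     []      p≼v           = inj₂ (p , refl , p≼v)
  ≼-compare {[]}    (a ∷ u) _             = inj₁ (a ∷ u , refl)
  ≼-compare {b ∷ p} (a ∷ u) (w , p++w≡) with ∷-injective p++w≡
  ... | refl , p++w≡′ with ≼-compare u (w , p++w≡′)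
  ...   | inj₁ (w′ , p++w′≡u)     = inj₁ (w′ , cong (a ∷_) p++w′≡u)
  ...   | inj₂ (q , p≡u++q , q≼v) = inj₂ (q , cong (a ∷_) p≡u++q , q≼v)

  -- Complete blocks `σ a` are peeled off as long as they fit into `p`; the first block that `p`
  -- fails to exhaust leaves the remainder `r`.
  ≼-desubstitute : ∀ σ u {p} → p ≼ concatMap σ u →
    ∃ λ q → ∃ λ r → ∃ λ a → q ≼ u × r ≼ σ a × p ≡ concatMap σ q ++ r
  -- The remainder is empty, so any letter would do; `zero` is a default.
  ≼-desubstitute σ [] {[]} _ = [] , [] , zero , ([] , refl) , (σ zero , refl) , refl
  ≼-desubstitute σ (a ∷ u) {p} p≼ with ≼-compare (σ a) p≼
  ... | inj₁ p≼σa = [] , p , a , (a ∷ u , refl) , p≼σa , refl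
  ... | inj₂ (p′ , p≡ , p′≼) with ≼-desubstitute σ u p′≼
  ...   | q , r , b , (w , q++w≡u) , r≼σb , p′≡ =
    a ∷ q , r , b , (w , cong (a ∷_) q++w≡u) , r≼σb ,
    trans p≡ (trans (cong (σ a ++_) p′≡) (sym (++-assoc (σ a) (concatMap σ q) r)))

  applyUpTo-+ : ∀ (ω : InfiniteWord) m n → applyUpTo ω (m + n) ≡ applyUpTo ω m ++ applyUpTo (ω ∘ (m +_)) n
  applyUpTo-+ ω zero    n = refl
  applyUpTo-+ ω (suc m) n = cong (ω 0 ∷_) (applyUpTo-+ (ω ∘ suc) m n)

  applyUpTo-≼ : ∀ ω {m n} → m ≤ n → applyUpTo ω m ≼ applyUpTo ω n
  applyUpTo-≼ ω {m} {n} m≤n = _ , trans (sym (applyUpTo-+ ω m (n ℕ.∸ m))) (cong (applyUpTo ω) (m+[n∸m]≡n m≤n))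

  applyUpTo-≼∞ : ∀ ω n → applyUpTo ω n ≼∞ ω
  applyUpTo-≼∞ ω n = cong (applyUpTo ω) (length-applyUpTo ω n)

  ≼applyUpTo⇒≼∞ : ∀ ω n {u} → u ≼ applyUpTo ω n → u ≼∞ ω
  ≼applyUpTo⇒≼∞ ω n       {[]}    _ = refl
  ≼applyUpTo⇒≼∞ ω (suc n) {a ∷ u} (w , eq) with ∷-injective eq
  ... | refl , eq′ = cong (ω 0 ∷_) (≼applyUpTo⇒≼∞ (ω ∘ suc) n (w , eq′))

  -- As `σ` is non-erasing, the image of the first `length p` letters of `ω′` already covers `p`,
  -- which reduces the claim to finite words. The same property gives the length bound: `q` is no
  -- longer than its image, which is a prefix of `p`.
  ≼∞-desubstitute : ∀ {σ ω ω′} → NonErasing σ → ω IsImageUnder σ Of ω′ → ∀ p → p ≼∞ ω →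
    ∃ λ q → ∃ λ r → ∃ λ a → q ≼∞ ω′ × r ≼ σ a × p ≡ concatMap σ q ++ r × length q ≤ length p
  ≼∞-desubstitute {σ} {ω} {ω′} σ≢[] ω≡σω′ p p≼∞ω
    with ≼-desubstitute σ u (subst₂ _≼_ p≼∞ω (ω≡σω′ (length p)) (applyUpTo-≼ ω p≤σu))
    where
    u = applyUpTo ω′ (length p)
    p≤σu : length p ≤ length (concatMap σ u)
    p≤σu = subst (_≤ length (concatMap σ u)) (length-applyUpTo ω′ (length p)) (length≤length-concatMap σ≢[] u)
  ... | q , r , a , q≼u , r≼σa , refl =
    q , r , a , ≼applyUpTo⇒≼∞ ω′ _ q≼u , r≼σa , refl ,
    ≤-trans (length≤length-concatMap σ≢[] q) (length-++-≤ˡ (concatMap σ q))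

  applyUpTo-cong : ∀ {ω ω′ : InfiniteWord} → (∀ k → ω k ≡ ω′ k) → ∀ n → applyUpTo ω n ≡ applyUpTo ω′ n
  applyUpTo-cong ω≗ω′ zero    = refl
  applyUpTo-cong ω≗ω′ (suc n) = cong₂ _∷_ (ω≗ω′ 0) (applyUpTo-cong (ω≗ω′ ∘ suc) n)

open WordProperties
open import Data.Vec.Functional using ([]; _∷_)

-- Archimedean arguments, floors, and vectors of letter counts.

module RealProperties {c ℓ₁ ℓ₂} (ℝ : RealNumbers c ℓ₁ ℓ₂) where

  open RealNumbers ℝ
  open NCF ℝ
  open OrderedFieldProperties orderedField

  -- The Archimedean property applied to `ε⁻¹ * b`. The successor keeps the multiplier positive, so
  -- that it can be cancelled later.
  archimedean-* : ∀ {ε} → 0# < ε → ∀ b → ∃ λ m → b < fromℕ (suc m) * ε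
  archimedean-* {ε} 0<ε b = m , (begin-strict
    b                      ≈⟨ trans (*-congʳ εε⁻¹≈1) (*-identityˡ b) ⟨
    ε * ε⁻¹ * b            ≈⟨ *-assoc ε ε⁻¹ b ⟩
    ε * (ε⁻¹ * b)          <⟨ *-monoˡ-< 0<ε ε⁻¹b<m ⟩
    ε * fromℕ m            ≈⟨ *-comm ε _ ⟩
    fromℕ m * ε            ≤⟨ *-monoʳ-≤ (<⇒≤ 0<ε) (fromℕ-mono-≤ (ℕₚ.n≤1+n m)) ⟩
    fromℕ (suc m) * ε      ∎)
    where
    open ≤-Reasoning
    ε#0 = #-sym (<⇒# 0<ε)
    ε⁻¹ = ε ⁻¹[ ε#0 ]
    εε⁻¹≈1 = ⁻¹-inverseʳ ε ε#0
    m = proj₁ (archimedean (ε⁻¹ * b))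
    ε⁻¹b<m = proj₂ (archimedean (ε⁻¹ * b))

  -- The error `b m` is at most a / (m + 1). If `z < y`, then `y - z` is a positive lower bound for
  -- every `b m`, contradicting the Archimedean property.
  squeeze-≤ : ∀ {y z a} (b : ℕ → Carrier) → (∀ m → fromℕ (suc m) * b m ≤ a) →
              (∀ m → y ≤ z + b m) → y ≤ z
  squeeze-≤ {y} {z} {a} b mb≤a y≤z+b z<y =
    ≤-trans (*-monoˡ-≤ (0≤fromℕ (suc m)) ε≤b) (mb≤a m) a<mε
    where
    0<ε = x<y⇒0<y-x z<y
    m = proj₁ (archimedean-* 0<ε a)
    a<mε = proj₂ (archimedean-* 0<ε a)
    ε≤b : y - z ≤ b m
    ε≤b = +-cancelˡ-≤ z (≤-trans (≤-reflexive (+-diff z y)) (y≤z+b m))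

  floor-unique : ∀ {y y′} k k′ → y ≈ y′ → IsFloor y k → IsFloor y′ k′ → k ≡ k′
  floor-unique k k′ y≈y′ (k≤y , y<1+k) (k′≤y′ , y′<1+k′) = ℕₚ.≤-antisym
    (ℕₚ.≤-pred (fromℕ-cancel-< (≤-<-trans k≤y (<-respˡ-≈ (sym y≈y′) y′<1+k′))))
    (ℕₚ.≤-pred (fromℕ-cancel-< (≤-<-trans k′≤y′ (<-respˡ-≈ y≈y′ y<1+k))))

  -- Uniqueness of inverses. The Gauss image and the digit condition each bring their own proof of
  -- `t n # 0#`, and the two quotients must be identified.
  /-proof-irrelevant : ∀ {x} y (p q : y # 0#) → x / y [ p ] ≈ x / y [ q ]
  /-proof-irrelevant {x} y p q = *-congˡ (begin-equality
    y ⁻¹[ p ]                        ≈⟨ *-identityʳ _ ⟨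
    y ⁻¹[ p ] * 1#                   ≈⟨ *-congˡ (⁻¹-inverseʳ y q) ⟨
    y ⁻¹[ p ] * (y * y ⁻¹[ q ])      ≈⟨ solve 3 (λ i y j → i :* (y :* j) := (y :* i) :* j) refl _ y _ ⟩
    y * y ⁻¹[ p ] * y ⁻¹[ q ]        ≈⟨ *-congʳ (⁻¹-inverseʳ y p) ⟩
    1# * y ⁻¹[ q ]                   ≈⟨ *-identityˡ _ ⟩
    y ⁻¹[ q ]                        ∎)
    where open ≤-Reasoning

  x*[y/x]≈y : ∀ {x y} (p : x # 0#) → x * (y / x [ p ]) ≈ y
  x*[y/x]≈y {x} {y} p = trans (solve 3 (λ x y i → x :* (y :* i) := (x :* i) :* y) refl x y _)
    (trans (*-congʳ (⁻¹-inverseʳ x p)) (*-identityˡ y))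

  counts : Word → ℝ²
  counts u i = fromℕ ∣ u ∣⟨ i ⟩

  ·-cong : ∀ A v w → v ≈² w → A · v ≈² A · w
  ·-cong A v w v≈w i = +-cong (*-congˡ (v≈w zero)) (*-congˡ (v≈w (suc zero)))

  ⊗-· : ∀ A B v → (A ⊗ B) · v ≈² A · (B · v)
  ⊗-· A B v i = trans (+-cong (*-congʳ (entry zero)) (*-congʳ (entry (suc zero))))
    (solve 8 (λ a b p q r s v w →
      (a :* p :+ b :* r) :* v :+ (a :* q :+ b :* s) :* w := a :* (p :* v :+ q :* w) :+ b :* (r :* v :+ s :* w))
      refl _ _ _ _ _ _ _ _)
    where
    entry : ∀ j → fromℕ ((A ⊗ B) i j) ≈
      fromℕ (A i zero) * fromℕ (B zero j) + fromℕ (A i (suc zero)) * fromℕ (B (suc zero) j)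
    entry j = trans (fromℕ-+ (A i zero ℕ.* B zero j) _) (+-cong (fromℕ-* (A i zero) _) (fromℕ-* (A i (suc zero)) _))

  counts-concatMap : ∀ σ u → counts (concatMap σ u) ≈² incidenceMatrix σ · counts u
  counts-concatMap σ u i = trans (reflexive (≡.cong fromℕ (∣concatMap∣ σ u i)))
    (trans (fromℕ-+ (incidenceMatrix σ i zero ℕ.* ∣ u ∣⟨ zero ⟩) _)
      (+-cong (fromℕ-* (incidenceMatrix σ i zero) _) (fromℕ-* (incidenceMatrix σ i (suc zero)) _)))

  counts-++ : ∀ u v i → counts (u ++ v) i ≈ counts u i + counts v i
  counts-++ u v i = trans (reflexive (≡.cong fromℕ (∣++∣ u v i))) (fromℕ-+ ∣ u ∣⟨ i ⟩ _)

  ∥_∥₁ : ℝ² → Carrier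
  ∥ v ∥₁ = v zero + v (suc zero)

  counts-∥∥₁ : ∀ u → ∥ counts u ∥₁ ≈ fromℕ (length u)
  counts-∥∥₁ u = trans (sym (fromℕ-+ ∣ u ∣⟨ zero ⟩ _)) (reflexive (≡.cong fromℕ (∣0∣+∣1∣ u)))

  NonNegative : ℝ² → Set ℓ₂
  NonNegative v = ∀ i → 0# ≤ v i

  ·-nonNegative : ∀ A v → NonNegative v → NonNegative (A · v)
  ·-nonNegative A v 0≤v i = +-nonneg (*-nonneg (0≤fromℕ (A i zero)) (0≤v zero))
    (*-nonneg (0≤fromℕ (A i (suc zero))) (0≤v (suc zero)))

  -- With l = c₀ + c₁, the hypothesis puts c₀ (x + 1) = x c₀ + c₀ within b of l, and c₁ (x + 1) = x
  -- c₁ + c₁ within b of x l. Dividing by l (x + 1) leaves an error of at most b / l, since x + 1 ≥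
  -- 1, and this is below ε.
  frequencies-within : ∀ {x c₀ c₁ l b ε x+1⁻¹ l⁻¹} → 0# < x → 0# < l → 0# < ε → c₀ + c₁ ≈ l →
    (x + 1#) * x+1⁻¹ ≈ 1# → l * l⁻¹ ≈ 1# → Within b c₁ (x * c₀) → b < ε * l →
    ∣ c₀ * l⁻¹ - 1# * x+1⁻¹ ∣< ε × ∣ c₁ * l⁻¹ - x * x+1⁻¹ ∣< ε
  frequencies-within {x} {c₀} {c₁} {l} {b} {ε} 0<x 0<l 0<ε c₀+c₁≈l XX⁻¹≈1 ll⁻¹≈1 (c₁≤xc₀+b , xc₀≤c₁+b) b<εl =
    ( cross-multiply-< 0<l 0<X ll⁻¹≈1 XX⁻¹≈1 (≤-<-trans c₀X≤l+b (+-monoʳ-< _ b<εlX))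
    , cross-multiply-< 0<X 0<l XX⁻¹≈1 ll⁻¹≈1 (≤-<-trans l≤c₀X+b (+-monoʳ-< _ b<εXl))) ,
    ( cross-multiply-< 0<l 0<X ll⁻¹≈1 XX⁻¹≈1 (≤-<-trans c₁X≤xl+b (+-monoʳ-< _ b<εlX))
    , cross-multiply-< 0<X 0<l XX⁻¹≈1 ll⁻¹≈1 (≤-<-trans xl≤c₁X+b (+-monoʳ-< _ b<εXl)))
    where
    open ≤-Reasoning
    X = x + 1#
    0<X : 0# < X
    0<X = 0<x⇒0<x+1 0<x
    expand : ∀ c → c * X ≈ x * c + c
    expand c = trans (distribˡ c x 1#) (+-cong (*-comm c x) (*-identityʳ c))
    b<εlX : b < ε * (l * X)
    b<εlX = begin-strict
      b                 <⟨ b<εl ⟩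
      ε * l             ≈⟨ *-congˡ (*-identityʳ l) ⟨
      ε * (l * 1#)      ≤⟨ *-monoˡ-≤ (<⇒≤ 0<ε) (*-monoˡ-≤ (<⇒≤ 0<l) (x≤y+x (<⇒≤ 0<x))) ⟩
      ε * (l * X)       ∎
    b<εXl : b < ε * (X * l)
    b<εXl = <-respʳ-≈ (*-congˡ (*-comm l X)) b<εlX
    c₀X≤l+b : c₀ * X ≤ 1# * l + b
    c₀X≤l+b = begin
      c₀ * X                ≈⟨ expand c₀ ⟩
      x * c₀ + c₀           ≤⟨ +-monoˡ-≤ c₀ xc₀≤c₁+b ⟩
      c₁ + b + c₀           ≈⟨ solve 3 (λ c₀ c₁ b → c₁ :+ b :+ c₀ := c₀ :+ c₁ :+ b) refl c₀ c₁ b ⟩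
      c₀ + c₁ + b           ≈⟨ +-congʳ (trans c₀+c₁≈l (sym (*-identityˡ l))) ⟩
      1# * l + b            ∎
    l≤c₀X+b : 1# * l ≤ c₀ * X + b
    l≤c₀X+b = begin
      1# * l                ≈⟨ trans (*-identityˡ l) (sym c₀+c₁≈l) ⟩
      c₀ + c₁               ≤⟨ +-monoʳ-≤ c₀ c₁≤xc₀+b ⟩
      c₀ + (x * c₀ + b)     ≈⟨ solve 3 (λ c u b → c :+ (u :+ b) := u :+ c :+ b) refl c₀ (x * c₀) b ⟩
      x * c₀ + c₀ + b       ≈⟨ +-congʳ (expand c₀) ⟨
      c₀ * X + b            ∎
    c₁X≤xl+b : c₁ * X ≤ x * l + b
    c₁X≤xl+b = begin
      c₁ * X                       ≈⟨ expand c₁ ⟩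
      x * c₁ + c₁                  ≤⟨ +-monoʳ-≤ _ c₁≤xc₀+b ⟩
      x * c₁ + (x * c₀ + b)
        ≈⟨ solve 4 (λ x c₀ c₁ b → x :* c₁ :+ (x :* c₀ :+ b) := x :* (c₀ :+ c₁) :+ b) refl x c₀ c₁ b ⟩
      x * (c₀ + c₁) + b            ≈⟨ +-congʳ (*-congˡ c₀+c₁≈l) ⟩
      x * l + b                    ∎
    xl≤c₁X+b : x * l ≤ c₁ * X + b
    xl≤c₁X+b = begin
      x * l                        ≈⟨ *-congˡ c₀+c₁≈l ⟨
      x * (c₀ + c₁)                ≈⟨ distribˡ x c₀ c₁ ⟩
      x * c₀ + x * c₁              ≤⟨ +-monoˡ-≤ _ xc₀≤c₁+b ⟩
      c₁ + b + x * c₁              ≈⟨ solve 3 (λ c u b → c :+ b :+ u := u :+ c :+ b) refl c₁ (x * c₁) b ⟩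
      x * c₁ + c₁ + b              ≈⟨ +-congʳ (expand c₁) ⟨
      c₁ * X + b                   ∎

-- The iterates of the Gauss map and their digits.

module ExpansionProperties {c ℓ₁ ℓ₂} (ℝ : RealNumbers c ℓ₁ ℓ₂) where

  open RealNumbers ℝ
  open NCF ℝ
  open OrderedFieldProperties orderedField
  open RealProperties ℝ

  module _ {N : ℕ} (1≤N : N ≥ 1) {x : Carrier} (0≤x : 0# ≤ x) (x≤1 : x ≤ 1#)
           {d : ℕ → ℕ} (t : ℕ → Carrier) (t₀≈x : t 0 ≈ x)
           (gauss : ∀ n → IsGaussImage N (t n) (t (suc n)))
           (floor : ∀ n → Σ (t n # 0#) λ tₙ#0 → IsFloor (fromℕ N / t n [ tₙ#0 ]) (d n)) where

    private
      q : ℕ → Carrier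
      q n = fromℕ N / t n [ proj₁ (floor n) ]

    -- The Gauss image carries its own digit `k`, which uniqueness of the floor identifies with
    -- `d n`; the branch `at-zero` is excluded because `t n` is apart from 0.
    d+t≈N/t : ∀ n → fromℕ (d n) + t (suc n) ≈ q n
    d+t≈N/t n with gauss n
    ... | at-zero tₙ≈0 _ = contradiction (proj₁ (floor n)) (#-irrefl tₙ≈0)
    ... | non-zero tₙ#0 k isFloor t′≈ with floor-unique k (d n) (/-proof-irrelevant (t n) tₙ#0 (proj₁ (floor n))) isFloor (proj₂ (floor n))
    ...   | ≡.refl = trans (+-congˡ t′≈) (trans (+-diff _ _) (/-proof-irrelevant (t n) tₙ#0 (proj₁ (floor n))))

    t-recurrence : ∀ n → t n * (fromℕ (d n) + t (suc n)) ≈ fromℕ N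
    t-recurrence n = trans (*-congˡ (d+t≈N/t n)) (x*[y/x]≈y (proj₁ (floor n)))

    0≤t : ∀ n → 0# ≤ t n
    0≤t zero    = ≤-trans 0≤x (≤-reflexive (sym t₀≈x))
    0≤t (suc n) = +-cancelˡ-≤ (fromℕ (d n)) (≤-trans (≤-reflexive (+-identityʳ _))
      (≤-trans (proj₁ (proj₂ (floor n))) (≤-reflexive (sym (d+t≈N/t n)))))

    t≤1 : ∀ n → t n ≤ 1#
    t≤1 zero    = ≤-trans (≤-reflexive t₀≈x) x≤1
    t≤1 (suc n) = +-cancelˡ-≤ (fromℕ (d n)) (≤-trans (≤-reflexive (d+t≈N/t n))
      (≤-trans (<⇒≤ (proj₂ (proj₂ (floor n)))) (≤-reflexive (+-comm _ _))))

    0<t : ∀ n → 0# < t n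
    0<t n = nonneg∧#0⇒pos (0≤t n) (proj₁ (floor n))

    0<x : 0# < x
    0<x = <-respʳ-≈ t₀≈x (0<t 0)

    -- Since tₙ ≤ 1, N = tₙ (dₙ + tₙ₊₁) ≤ dₙ + tₙ₊₁ = N / tₙ < dₙ + 1, a comparison of natural
    -- numbers.
    N≤d : ∀ n → N ℕ.≤ d n
    N≤d n = ℕₚ.≤-pred (fromℕ-cancel-< (begin-strict
      fromℕ N                               ≈⟨ t-recurrence n ⟨
      t n * (fromℕ (d n) + t (suc n))       ≤⟨ *-monoʳ-≤ (+-nonneg (0≤fromℕ (d n)) (0≤t (suc n))) (t≤1 n) ⟩
      1# * (fromℕ (d n) + t (suc n))        ≈⟨ trans (*-identityˡ _) (d+t≈N/t n) ⟩
      q n                                   <⟨ proj₂ (proj₂ (floor n)) ⟩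
      fromℕ (suc (d n))                     ∎))
      where open ≤-Reasoning

    1≤d : ∀ n → 1 ℕ.≤ d n
    1≤d n = ℕₚ.≤-trans 1≤N (N≤d n)

    td≤N : ∀ n → t n * fromℕ (d n) ≤ fromℕ N
    td≤N n = ≤-trans (*-monoˡ-≤ (0≤t n) (x≤x+y (0≤t (suc n)))) (≤-reflexive (t-recurrence n))

    -- Decay of the products t₀ ⋯ tₙ₋₁.

    contraction : ℕ → Carrier
    contraction zero    = 1#
    contraction (suc n) = contraction n * t n

    0≤contraction : ∀ n → 0# ≤ contraction n
    0≤contraction zero    = 0≤1
    0≤contraction (suc n) = *-nonneg (0≤contraction n) (0≤t n)

    contraction≤1 : ∀ n → contraction n ≤ 1#
    contraction≤1 zero    = ≤-refl
    contraction≤1 (suc n) = ≤-trans (*-monoˡ-≤ (0≤contraction n) (t≤1 n))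
      (≤-trans (≤-reflexive (*-identityʳ _)) (contraction≤1 n))

    -- For a single factor only `t n ≤ 1#` is known, so two are taken together: tₙ tₙ₊₁ N ≤ tₙ dₙ by
    -- tₙ₊₁ ≤ 1 and N ≤ dₙ, and adding tₙ tₙ₊₁ completes the right side to tₙ (dₙ + tₙ₊₁) = N.
    tt′[N+1]≤N : ∀ n → t n * t (suc n) * (fromℕ N + 1#) ≤ fromℕ N
    tt′[N+1]≤N n = begin
      a * b * (fromℕ N + 1#)         ≈⟨ distribˡ _ _ _ ⟩
      a * b * fromℕ N + a * b * 1#   ≤⟨ +-mono-≤ ab*N≤a*d (≤-reflexive (*-identityʳ _)) ⟩
      a * fromℕ (d n) + a * b        ≈⟨ trans (sym (distribˡ _ _ _)) (t-recurrence n) ⟩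
      fromℕ N                        ∎
      where
      open ≤-Reasoning
      a = t n
      b = t (suc n)
      ab*N≤a*d : a * b * fromℕ N ≤ a * fromℕ (d n)
      ab*N≤a*d = begin
        a * b * fromℕ N     ≈⟨ *-assoc _ _ _ ⟩
        a * (b * fromℕ N)   ≤⟨ *-monoˡ-≤ (0≤t n) (*-monoʳ-≤ (0≤fromℕ N) (t≤1 (suc n))) ⟩
        a * (1# * fromℕ N)  ≈⟨ *-congˡ (*-identityˡ _) ⟩
        a * fromℕ N         ≤⟨ *-monoˡ-≤ (0≤t n) (fromℕ-mono-≤ (N≤d n)) ⟩
        a * fromℕ (d n)     ∎

    -- Pairs of factors contract by N/(N+1); N/(N+m) dominates their m-fold product.
    contraction-decay : ∀ m → (fromℕ N + fromℕ m) * contraction (m ℕ.* 2) ≤ fromℕ N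
    contraction-decay zero    = ≤-reflexive (trans (*-identityʳ _) (+-identityʳ _))
    contraction-decay (suc m) = begin
      (fromℕ N + (1# + fromℕ m)) * (p * a * b)
        ≈⟨ solve 6 (λ n e m p a b → (n :+ (e :+ m)) :* (p :* a :* b) := a :* b :* ((n :+ m) :* p) :+ a :* b :* (p :* e)) refl (fromℕ N) 1# (fromℕ m) p a b ⟩
      a * b * ((fromℕ N + fromℕ m) * p) + a * b * (p * 1#)
        ≤⟨ +-mono-≤ (*-monoˡ-≤ 0≤ab (contraction-decay m)) (*-monoˡ-≤ 0≤ab (≤-trans (≤-reflexive (*-identityʳ p)) (contraction≤1 (m ℕ.* 2)))) ⟩
      a * b * fromℕ N + a * b * 1#                     ≈⟨ distribˡ _ _ _ ⟨
      a * b * (fromℕ N + 1#)                           ≤⟨ tt′[N+1]≤N (m ℕ.* 2) ⟩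
      fromℕ N                                          ∎
      where
      open ≤-Reasoning
      p = contraction (m ℕ.* 2)
      a = t (m ℕ.* 2)
      b = t (suc (m ℕ.* 2))
      0≤ab = *-nonneg (0≤t (m ℕ.* 2)) (0≤t (suc (m ℕ.* 2)))

    m*contraction≤N : ∀ m → fromℕ m * contraction (m ℕ.* 2) ≤ fromℕ N
    m*contraction≤N m = ≤-trans (*-monoʳ-≤ (0≤contraction (m ℕ.* 2)) (x≤y+x (0≤fromℕ N))) (contraction-decay m)

    -- The action of the matrices on δₙ, the cones and the rays.

    private
      σ : ℕ → Substitution
      σ = directiveSequence N d

      M : ℕ → Matrix₂
      M n = incidenceMatrix (σ n)

    M·-zero : ∀ n w → (M n · w) zero ≈ fromℕ (d n) * w zero + w (suc zero)
    M·-zero n w = +-cong (*-congʳ (reflexive (≡.cong fromℕ (incidence₀₀ N (d n)))))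
                         (trans (*-congʳ fromℕ-1) (*-identityˡ _))

    M·-one : ∀ n w → (M n · w) (suc zero) ≈ fromℕ N * w zero
    M·-one n w = trans (+-cong (*-congʳ (reflexive (≡.cong fromℕ (incidence₁₀ N (d n))))) (zeroˡ _))
                       (+-identityʳ _)

    -- ∣δₙ(v)∣ ≤ b
    Slope : ℕ → Carrier → ℝ² → Set ℓ₂
    Slope n b v = Within b (v (suc zero)) (t n * v zero)

    Slope-cong : ∀ n {b} v w → v ≈² w → Slope n b v → Slope n b w
    Slope-cong n v w v≈w = Within-cong refl (v≈w (suc zero)) (*-congˡ (v≈w zero))

    Slope-∥∥₁ : ∀ n v → NonNegative v → Slope n ∥ v ∥₁ v
    Slope-∥∥₁ n v 0≤v =
      ≤-trans (x≤y+x (0≤v zero)) (x≤y+x (*-nonneg (0≤t n) (0≤v zero))) ,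
      ≤-trans (≤-trans (*-monoʳ-≤ (0≤v zero) (t≤1 n)) (≤-reflexive (*-identityˡ _)))
        (≤-trans (x≤x+y (0≤v (suc zero))) (x≤y+x (0≤v (suc zero))))

    -- Once N is replaced by tₙ (dₙ + tₙ₊₁), both compared quantities contain the summand tₙ dₙ w₀.
    -- What remains is the pair for `w` at level n + 1, scaled by tₙ and with its sides exchanged;
    -- `Within-sym` absorbs this change of sign.
    Slope-M : ∀ n {b} w → Slope (suc n) b w → Slope n (t n * b) (M n · w)
    Slope-M n {b} w slope = Within-cong refl (sym v₁≈) (sym v₀≈)
      (Within-translate (Within-scale (0≤t n) (Within-sym slope)))
      where
      v₁≈ : (M n · w) (suc zero) ≈ t n * fromℕ (d n) * w zero + t n * (t (suc n) * w zero)
      v₁≈ = trans (M·-one n w) (trans (*-congʳ (sym (t-recurrence n)))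
        (solve 4 (λ a d a′ w → a :* (d :+ a′) :* w := a :* d :* w :+ a :* (a′ :* w)) refl _ _ _ _))
      v₀≈ : t n * (M n · w) zero ≈ t n * fromℕ (d n) * w zero + t n * w (suc zero)
      v₀≈ = trans (*-congˡ (M·-zero n w))
        (solve 4 (λ a d w v → a :* (d :* w :+ v) := a :* d :* w :+ a :* v) refl _ _ _ _)

    P : ℕ → Matrix₂
    P = leadingProduct M

    -- `P n` has n + 1 factors, so it starts from level `suc n` and scales by `contraction (suc n)`.
    -- The induction peels off the rightmost matrix.
    Slope-P : ∀ n {b} w → Slope (suc n) b w → Slope 0 (contraction (suc n) * b) (P n · w)
    Slope-P zero    w slope = Within-weaken (≤-reflexive (*-congʳ (sym (*-identityˡ _)))) (Slope-M 0 w slope)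
    Slope-P (suc n) w slope = Within-weaken (≤-reflexive (sym (*-assoc _ _ _)))
      (Slope-cong 0 _ _ (λ i → sym (⊗-· (P n) (M (suc n)) w i)) (Slope-P n (M (suc n) · w) (Slope-M (suc n) w slope)))

    -- The entry dₙ w₀ + w₁ alone suffices, because dₙ ≥ 1. This allows the norm of a preimage,
    -- which varies with the cone, to be replaced by the norm of the fixed vector `v`.
    ∥∥₁≤∥M∥₁ : ∀ n w → NonNegative w → ∥ w ∥₁ ≤ ∥ M n · w ∥₁
    ∥∥₁≤∥M∥₁ n w 0≤w = begin
      w zero + w (suc zero)                       ≈⟨ +-congʳ (trans (*-congʳ fromℕ-1) (*-identityˡ _)) ⟨
      fromℕ 1 * w zero + w (suc zero)
        ≤⟨ +-monoˡ-≤ _ (*-monoʳ-≤ (0≤w zero) (fromℕ-mono-≤ (1≤d n))) ⟩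
      fromℕ (d n) * w zero + w (suc zero)         ≈⟨ M·-zero n w ⟨
      (M n · w) zero                              ≤⟨ x≤x+y (·-nonNegative (M n) w 0≤w (suc zero)) ⟩
      ∥ M n · w ∥₁                                ∎
      where open ≤-Reasoning

    ∥∥₁≤∥P∥₁ : ∀ n w → NonNegative w → ∥ w ∥₁ ≤ ∥ P n · w ∥₁
    ∥∥₁≤∥P∥₁ zero    w 0≤w = ∥∥₁≤∥M∥₁ 0 w 0≤w
    ∥∥₁≤∥P∥₁ (suc n) w 0≤w = ≤-trans (∥∥₁≤∥M∥₁ (suc n) w 0≤w)
      (≤-trans (∥∥₁≤∥P∥₁ n (M (suc n) · w) (·-nonNegative (M (suc n)) w 0≤w))
        (≤-reflexive (sym (+-cong (⊗-· (P n) (M (suc n)) w zero) (⊗-· (P n) (M (suc n)) w (suc zero))))))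

    ∈Cone⇒Slope : ∀ n v → v ∈Cone P n → Slope 0 (contraction (suc n) * ∥ v ∥₁) v
    ∈Cone⇒Slope n v (w , 0<w , v≈Pw) = Slope-cong 0 _ v (λ i → sym (v≈Pw i))
      (Within-weaken (*-monoˡ-≤ (0≤contraction (suc n))
          (≤-trans (∥∥₁≤∥P∥₁ n w 0≤w) (≤-reflexive (sym (+-cong (v≈Pw zero) (v≈Pw (suc zero)))))))
        (Slope-P n w (Slope-∥∥₁ (suc n) w 0≤w)))
      where
      0≤w : NonNegative w
      0≤w i = <⇒≤ (0<w i)

    ∈Cones⇒proportional : ∀ v → (∀ n → v ∈Cone P n) → v (suc zero) ≈ t 0 * v zero
    ∈Cones⇒proportional v v∈Cone = ≤-antisym
      (squeeze-≤ b mb≤N∥v∥ (proj₁ ∘ slope)) (squeeze-≤ b mb≤N∥v∥ (proj₂ ∘ slope))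
      where
      b : ℕ → Carrier
      -- Decay is known along even numbers of factors only. Cone number 2m + 1 involves 2m + 2
      -- matrices, which gives the index `suc m ℕ.* 2`.
      b m = contraction (suc m ℕ.* 2) * ∥ v ∥₁
      slope : ∀ m → Slope 0 (b m) v
      slope m = ∈Cone⇒Slope (suc (m ℕ.* 2)) v (v∈Cone (suc (m ℕ.* 2)))
      -- The sign of `v` is read off from its membership in the first cone.
      0≤∥v∥ : 0# ≤ ∥ v ∥₁
      0≤∥v∥ with v∈Cone 0
      ... | w , 0<w , v≈Mw = ≤-trans (+-nonneg {(M 0 · w) zero} (0≤Mw zero) (0≤Mw (suc zero)))
        (≤-reflexive (sym (+-cong (v≈Mw zero) (v≈Mw (suc zero)))))
        where
        0≤Mw : NonNegative (M 0 · w)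
        0≤Mw = ·-nonNegative (M 0) w (λ i → <⇒≤ (0<w i))
      mb≤N∥v∥ : ∀ m → fromℕ (suc m) * b m ≤ fromℕ N * ∥ v ∥₁
      mb≤N∥v∥ m = ≤-trans (≤-reflexive (sym (*-assoc _ _ _))) (*-monoʳ-≤ 0≤∥v∥ (m*contraction≤N (suc m)))

    ∈Cone⇒0<v₀ : ∀ v → v ∈Cone P 0 → 0# < v zero
    ∈Cone⇒0<v₀ v (w , 0<w , v≈Mw) = <-respʳ-≈ (sym (trans (v≈Mw zero) (M·-zero 0 w)))
      (<-respʳ-≈ (+-comm _ _) (+-pos-nonneg (0<w (suc zero)) (*-nonneg (0≤fromℕ (d 0)) (<⇒≤ (0<w zero)))))

    ray : ℕ → Carrier → ℝ²
    ray n r = r ∷ r * t n ∷ []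

    ray-positive : ∀ n {r} → 0# < r → Positive (ray n r)
    ray-positive n 0<r zero       = 0<r
    ray-positive n 0<r (suc zero) = *-pos 0<r (0<t n)

    -- The scalar s = r / (dₙ + tₙ₊₁) is forced by the first coordinate, dₙ s + tₙ₊₁ s = r. The
    -- second then agrees: N s = tₙ (dₙ + tₙ₊₁) s = r tₙ.
    ray-M : ∀ n {r} → 0# < r → ∃ λ s → 0# < s × ray n r ≈² M n · ray (suc n) s
    ray-M n {r} 0<r = r * e⁻¹ , *-pos 0<r (inverse-pos 0<e ee⁻¹≈1) , λ where
        zero       → begin-equality
          r
            ≈⟨ trans (*-congˡ ee⁻¹≈1) (*-identityʳ r) ⟨
          r * (e * e⁻¹)
            ≈⟨ solve 4 (λ r d t′ i → r :* ((d :+ t′) :* i) := d :* (r :* i) :+ r :* i :* t′) refl r _ _ e⁻¹ ⟩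
          fromℕ (d n) * (r * e⁻¹) + r * e⁻¹ * t (suc n)             ≈⟨ M·-zero n (ray (suc n) (r * e⁻¹)) ⟨
          (M n · ray (suc n) (r * e⁻¹)) zero                        ∎
        (suc zero) → begin-equality
          r * t n
            ≈⟨ trans (*-congˡ ee⁻¹≈1) (*-identityʳ _) ⟨
          r * t n * (e * e⁻¹)
            ≈⟨ solve 4 (λ r t e i → r :* t :* (e :* i) := t :* e :* (r :* i)) refl r _ e e⁻¹ ⟩
          t n * e * (r * e⁻¹)                                       ≈⟨ *-congʳ (t-recurrence n) ⟩
          fromℕ N * (r * e⁻¹)                                       ≈⟨ M·-one n (ray (suc n) (r * e⁻¹)) ⟨
          (M n · ray (suc n) (r * e⁻¹)) (suc zero)                  ∎
      where
      open ≤-Reasoning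
      e = fromℕ (d n) + t (suc n)
      0<e : 0# < e
      0<e = <-respʳ-≈ (+-comm _ _) (+-pos-nonneg (0<t (suc n)) (0≤fromℕ (d n)))
      e#0 = #-sym (<⇒# 0<e)
      e⁻¹ = e ⁻¹[ e#0 ]
      ee⁻¹≈1 = ⁻¹-inverseʳ e e#0

    ray-P : ∀ n {r} → 0# < r → ∃ λ s → 0# < s × ray 0 r ≈² P n · ray (suc n) s
    ray-P zero        0<r = ray-M 0 0<r
    ray-P (suc n) {r} 0<r = s′ , proj₁ (proj₂ step) , λ i → begin-equality
      ray 0 r i                                       ≈⟨ proj₂ (proj₂ (ray-P n 0<r)) i ⟩
      (P n · ray (suc n) s) i
        ≈⟨ ·-cong (P n) (ray (suc n) s) (M (suc n) · ray (suc (suc n)) s′) (proj₂ (proj₂ step)) i ⟩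
      (P n · (M (suc n) · ray (suc (suc n)) s′)) i    ≈⟨ ⊗-· (P n) (M (suc n)) (ray (suc (suc n)) s′) i ⟨
      (P (suc n) · ray (suc (suc n)) s′) i            ∎
      where
      open ≤-Reasoning
      s = proj₁ (ray-P n 0<r)
      step = ray-M (suc n) (proj₁ (proj₂ (ray-P n 0<r)))
      s′ = proj₁ step

    -- Prefixes of the NCF sequence.

    Slope-≼σ : ∀ n a {r} → r ≼ σ n a → Slope n (fromℕ N) (counts r)
    Slope-≼σ n a {r} (s , r++s≡) =
      -- Both ∣r∣₁ and tₙ ∣r∣₀ lie between 0 and N: a block has at most N ones and at most dₙ zeros,
      -- and tₙ dₙ ≤ N. For the block of the letter 1 the zero count is 1, which is at most dₙ.
      ≤-trans (fromℕ-mono-≤ (∣r∣₁≤N a r++s≡)) (x≤y+x (*-nonneg (0≤t n) (0≤fromℕ ∣ r ∣⟨ zero ⟩))) ,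
      ≤-trans (*-monoˡ-≤ (0≤t n) (fromℕ-mono-≤ (∣r∣₀≤d a r++s≡)))
        (≤-trans (td≤N n) (x≤y+x (0≤fromℕ ∣ r ∣⟨ suc zero ⟩)))
      where
      ∣r∣≤∣σ∣ : ∀ a b → r ++ s ≡ σ n a → ∣ r ∣⟨ b ⟩ ℕ.≤ ∣ σ n a ∣⟨ b ⟩
      ∣r∣≤∣σ∣ a b eq = ≡.subst (λ u → ∣ r ∣⟨ b ⟩ ℕ.≤ ∣ u ∣⟨ b ⟩) eq (∣∣-monoˡ r s b)
      ∣r∣₀≤d : ∀ a → r ++ s ≡ σ n a → ∣ r ∣⟨ zero ⟩ ℕ.≤ d n
      ∣r∣₀≤d zero       eq = ≡.subst (_ ℕ.≤_) (incidence₀₀ N (d n)) (∣r∣≤∣σ∣ zero zero eq)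
      ∣r∣₀≤d (suc zero) eq = ℕₚ.≤-trans (∣r∣≤∣σ∣ (suc zero) zero eq) (1≤d n)
      ∣r∣₁≤N : ∀ a → r ++ s ≡ σ n a → ∣ r ∣⟨ suc zero ⟩ ℕ.≤ N
      ∣r∣₁≤N zero       eq = ≡.subst (_ ℕ.≤_) (incidence₁₀ N (d n)) (∣r∣≤∣σ∣ zero (suc zero) eq)
      ∣r∣₁≤N (suc zero) eq = ℕₚ.≤-trans (∣r∣≤∣σ∣ (suc zero) (suc zero) eq) z≤n

    Slope-σ : ∀ n q a {r b} → r ≼ σ n a → Slope (suc n) b (counts q) →
              Slope n (t n * b + fromℕ N) (counts (concatMap (σ n) q ++ r))
    Slope-σ n q a {r} {b} r≼σa slope = Within-cong refl (sym (counts≈ (suc zero)))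
      (trans (sym (distribˡ _ _ _)) (*-congˡ (sym (counts≈ zero))))
      (Within-+ (Slope-M n (counts q) slope) (Slope-≼σ n a r≼σa))
      where
      counts≈ : ∀ i → counts (concatMap (σ n) q ++ r) i ≈ (M n · counts q) i + counts r i
      counts≈ i = trans (counts-++ (concatMap (σ n) q) r i) (+-congʳ (counts-concatMap (σ n) q i))

    module _ {ω⁽_⁾ : ℕ → InfiniteWord} (isImage : ∀ n → ω⁽ n ⁾ IsImageUnder σ n Of ω⁽ suc n ⁾) where

      -- The bound `b` at level n is left open, so that the inductive step can instantiate it with
      -- tₙ b + N, the bound obtained from one level further down plus an incomplete block.
      Slope-desubstitute : ∀ n p → p ≼∞ ω⁽ 0 ⁾ → ∃ λ q → q ≼∞ ω⁽ n ⁾ × length q ℕ.≤ length p ×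
        (∀ b → Slope n b (counts q) → Slope 0 (contraction n * b + fromℕ N * fromℕ n) (counts p))
      Slope-desubstitute zero    p p≼∞ω = p , p≼∞ω , ℕₚ.≤-refl , λ b →
        Within-weaken (≤-reflexive (sym (trans (+-cong (*-identityˡ b) (zeroʳ (fromℕ N))) (+-identityʳ b))))
      Slope-desubstitute (suc n) p p≼∞ω =
        let q , q≼∞ω , ∣q∣≤∣p∣ , lift = Slope-desubstitute n p p≼∞ω
            q′ , r , a , q′≼∞ω , r≼σa , q≡ , ∣q′∣≤∣q∣ =
              ≼∞-desubstitute {σ n} (ncfSubstitution-nonErasing N (1≤d n)) (isImage n) q q≼∞ω
        in q′ , q′≼∞ω , ℕₚ.≤-trans ∣q′∣≤∣q∣ ∣q∣≤∣p∣ , λ b slope →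
             Within-weaken (bound b) (lift (t n * b + fromℕ N)
               (≡.subst (Slope n (t n * b + fromℕ N) ∘ counts) (≡.sym q≡) (Slope-σ n q′ a r≼σa slope)))
        where
        open ≤-Reasoning
        C = contraction n
        bound : ∀ b → C * (t n * b + fromℕ N) + fromℕ N * fromℕ n ≤ C * t n * b + fromℕ N * (1# + fromℕ n)
        bound b = begin
          C * (t n * b + fromℕ N) + fromℕ N * fromℕ n
            ≈⟨ solve 5 (λ c t b e n → c :* (t :* b :+ e) :+ n := c :* t :* b :+ (c :* e :+ n)) refl C (t n) b (fromℕ N) (fromℕ N * fromℕ n) ⟩
          C * t n * b + (C * fromℕ N + fromℕ N * fromℕ n)
            -- The new block costs N times the contraction so far, which is at most 1; hence N per
            -- level.
            ≤⟨ +-monoʳ-≤ _ (+-monoˡ-≤ _ (*-monoʳ-≤ (0≤fromℕ N) (contraction≤1 n))) ⟩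
          C * t n * b + (1# * fromℕ N + fromℕ N * fromℕ n)
            ≈⟨ +-congˡ (solve 3 (λ o e n → o :* e :+ e :* n := e :* (o :+ n)) refl 1# (fromℕ N) (fromℕ n)) ⟩
          C * t n * b + fromℕ N * (1# + fromℕ n)               ∎

      -- The open bound is instantiated with ∣p∣: at level n the error is at most ∣q∣, and
      -- desubstitution does not lengthen words.
      Slope-prefix : ∀ n p → p ≼∞ ω⁽ 0 ⁾ →
        Slope 0 (contraction n * fromℕ (length p) + fromℕ N * fromℕ n) (counts p)
      Slope-prefix n p p≼∞ω =
        let q , _ , ∣q∣≤∣p∣ , lift = Slope-desubstitute n p p≼∞ω
        in lift (fromℕ (length p)) (Within-weaken
             (≤-trans (≤-reflexive (counts-∥∥₁ q)) (fromℕ-mono-≤ ∣q∣≤∣p∣))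
             (Slope-∥∥₁ n (counts q) (λ i → 0≤fromℕ ∣ q ∣⟨ i ⟩)))

    -- Letter frequencies and the eigenvector.

    private
      x+1#0 = 0≤x⇒x+1#0 0≤x
      x+1⁻¹ = (x + 1#) ⁻¹[ x+1#0 ]
      XX⁻¹≈1 = ⁻¹-inverseʳ (x + 1#) x+1#0
      f₀ = 1# / (x + 1#) [ x+1#0 ]
      f₁ = x / (x + 1#) [ x+1#0 ]

    -- Choose m with 2N < (m + 1) ε and k = 2 (m + 1), so that (m + 1) times the contraction is at
    -- most N. For l ≥ K = (m + 1) k, the multiple (m + 1) N k is at most N (l + 1). Hence m + 1
    -- times the left side is at most 2N (l + 1), and m + 1 cancels. The depth `k` depends on `ε`
    -- but not on the length of the prefix.
    sublinear : ∀ {ε} → 0# < ε → ∃ λ k → ∃ λ K → ∀ l → K ℕ.≤ l →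
      contraction k * fromℕ (suc l) + fromℕ N * fromℕ k < ε * fromℕ (suc l)
    sublinear {ε} 0<ε = k , suc m ℕ.* k , λ l K≤l → *-cancelˡ-< (0<fromℕ[1+n] m) (begin-strict
      m⁺ * (C * fromℕ (suc l) + fromℕ N * fromℕ k)
        ≈⟨ solve 5 (λ m C l n k → m :* (C :* l :+ n :* k) := m :* C :* l :+ n :* (m :* k)) refl m⁺ C (fromℕ (suc l)) (fromℕ N) (fromℕ k) ⟩
      m⁺ * C * fromℕ (suc l) + fromℕ N * (m⁺ * fromℕ k)       ≤⟨ +-mono-≤
          (*-monoʳ-≤ (0≤fromℕ (suc l)) (m*contraction≤N (suc m)))
          (*-monoˡ-≤ (0≤fromℕ N) (≤-trans (≤-reflexive (sym (fromℕ-* (suc m) k))) (fromℕ-mono-≤ (ℕₚ.m≤n⇒m≤1+n K≤l)))) ⟩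
      fromℕ N * fromℕ (suc l) + fromℕ N * fromℕ (suc l)     ≈⟨ trans (sym (distribʳ _ _ _)) (*-comm _ _) ⟩
      fromℕ (suc l) * (fromℕ N + fromℕ N)
        <⟨ *-monoˡ-< (0<fromℕ[1+n] l) (proj₂ (archimedean-* 0<ε (fromℕ N + fromℕ N))) ⟩
      fromℕ (suc l) * (m⁺ * ε)
        ≈⟨ solve 3 (λ l m ε → l :* (m :* ε) := m :* (ε :* l)) refl (fromℕ (suc l)) m⁺ ε ⟩
      m⁺ * (ε * fromℕ (suc l))                               ∎)
      where
      open ≤-Reasoning
      m = proj₁ (archimedean-* 0<ε (fromℕ N + fromℕ N))
      k = suc m ℕ.* 2
      m⁺ = fromℕ (suc m)
      C = contraction k

    -- Both letters share one threshold `K`, since a single bound on δ₀ of the prefix controls both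
    -- frequencies.
    prefix-frequencies : ∀ {ω} → IsNCFSequence N d ω → ∀ ε → 0# < ε → ∃ λ K → ∀ n → K ℕ.≤ n →
      ∣ prefixFrequency zero ω n - f₀ ∣< ε × ∣ prefixFrequency (suc zero) ω n - f₁ ∣< ε
    prefix-frequencies {ω} (ω⁽_⁾ , ω⁽⁰⁾≡ω , isImage) ε 0<ε = K , λ n K≤n →
      let p = applyUpTo ω (suc n)
          ∣p∣≡1+n = length-applyUpTo ω (suc n)
          p≼∞ω⁽⁰⁾ = ≡.trans (applyUpTo-cong ω⁽⁰⁾≡ω (length p)) (applyUpTo-≼∞ ω (suc n))
          slope = Slope-prefix isImage k p p≼∞ω⁽⁰⁾
      in frequencies-within 0<x (0<fromℕ[1+n] n) 0<ε
           (trans (counts-∥∥₁ p) (reflexive (≡.cong fromℕ ∣p∣≡1+n)))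
           XX⁻¹≈1 (⁻¹-inverseʳ (fromℕ (suc n)) (fromℕ[1+n]#0 n))
           (Within-cong (reflexive (≡.cong (λ l → contraction k * fromℕ l + fromℕ N * fromℕ k) ∣p∣≡1+n))
             refl (*-congʳ t₀≈x) slope)
           (bound n K≤n)
      where
      k = proj₁ (sublinear 0<ε)
      K = proj₁ (proj₂ (sublinear 0<ε))
      bound = proj₂ (proj₂ (sublinear 0<ε))

    isGeneralizedRightEigenvector : IsGeneralizedRightEigenvector (directiveSequence N d) (f₀ ∷ f₁ ∷ [])
    isGeneralizedRightEigenvector = record
      { positive     = λ where
          zero       → *-pos 0<1 0<x+1⁻¹
          (suc zero) → *-pos 0<x 0<x+1⁻¹
      ; normalised   = trans (sym (distribʳ _ _ _)) (trans (*-congʳ (+-comm _ _)) XX⁻¹≈1)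
      ; intersection = λ v → mk⇔ (cones⇒ray v) (ray⇒cones v)
      }
      where
      open ≤-Reasoning
      0<x+1 = 0<x⇒0<x+1 0<x
      0<x+1⁻¹ = inverse-pos 0<x+1 XX⁻¹≈1
      u : ℝ²
      u = f₀ ∷ f₁ ∷ []

      cones⇒ray : ∀ v → (∀ n → v ∈Cone P n) → v ∈Ray u
      -- The first coordinate of `u` is 1 / (x + 1), which forces this scalar; the second then
      -- matches because v₁ = x v₀.
      cones⇒ray v v∈Cone = v zero * (x + 1#) ,
        *-pos (∈Cone⇒0<v₀ v (v∈Cone 0)) 0<x+1 , λ where
          zero       → trans (sym (*-identityˡ _)) (sym (scale 1#))
          (suc zero) → trans (trans (∈Cones⇒proportional v v∈Cone) (*-congʳ t₀≈x)) (sym (scale x))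
        where
        scale : ∀ y → v zero * (x + 1#) * (y * x+1⁻¹) ≈ y * v zero
        scale y = trans (solve 4 (λ v X y i → v :* X :* (y :* i) := y :* v :* (X :* i)) refl (v zero) (x + 1#) y x+1⁻¹)
          (trans (*-congˡ XX⁻¹≈1) (*-identityʳ _))

      ray⇒cones : ∀ v → v ∈Ray u → ∀ n → v ∈Cone P n
      ray⇒cones v (r , 0<r , v≈ru) n = ray (suc n) s , ray-positive (suc n) (proj₁ (proj₂ step)) ,
        λ i → trans (v≈ray i) (proj₂ (proj₂ step) i)
        where
        -- As f₁ = x f₀, the vector `r ∙ u` is the point of the level 0 ray with first coordinate
        -- `r * f₀`.
        step = ray-P n (*-pos 0<r (*-pos 0<1 0<x+1⁻¹))
        s = proj₁ step
        v≈ray : v ≈² ray 0 (r * f₀)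
        v≈ray zero       = v≈ru zero
        v≈ray (suc zero) = begin-equality
          v (suc zero)                ≈⟨ v≈ru (suc zero) ⟩
          r * (x * x+1⁻¹)             ≈⟨ *-congˡ (*-congˡ (*-identityˡ _)) ⟨
          r * (x * f₀)                ≈⟨ solve 3 (λ r x f → r :* (x :* f) := r :* f :* x) refl r x f₀ ⟩
          r * f₀ * x                  ≈⟨ *-congˡ t₀≈x ⟨
          r * f₀ * t 0                ∎

lemma3p6 : ∀ {c ℓ₁ ℓ₂} (ℝ : RealNumbers c ℓ₁ ℓ₂) →
    let open RealNumbers ℝ
        open NCF ℝ
    in
    (N : ℕ) → N ≥ 1 →
    (x : Carrier) (0≤x : 0# ≤ x) → x ≤ 1# → Irrational x →
    (d : ℕ → ℕ) → IsNCFExpansion N x d →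
    let x+1#0 = 0≤x⇒x+1#0 0≤x
        f₀    = 1# / (x + 1#) [ x+1#0 ]
        f₁    = x / (x + 1#) [ x+1#0 ]
    in
    ((ω : InfiniteWord) → IsNCFSequence N d ω →
      HasFrequency ω zero f₀ × HasFrequency ω (suc zero) f₁) ×
    IsGeneralizedRightEigenvector (directiveSequence N d) (f₀ ∷ f₁ ∷ [])
lemma3p6 ℝ N 1≤N x 0≤x x≤1 _ d (t , t₀≈x , gauss , floor) =
  (λ ω isNCF →
    (λ ε 0<ε → let K , within = frequencies isNCF ε 0<ε in K , λ n K≤n → proj₁ (within n K≤n)) ,
    (λ ε 0<ε → let K , within = frequencies isNCF ε 0<ε in K , λ n K≤n → proj₂ (within n K≤n))) ,
  isGeneralizedRightEigenvector 1≤N 0≤x x≤1 t t₀≈x gauss floor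
  where
  open ExpansionProperties ℝ
  frequencies = λ {ω} → prefix-frequencies 1≤N 0≤x x≤1 t t₀≈x gauss floor {ω}
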